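{- For all integers $g\ge 3$ and $d\ge 1$, there exists a finite non-empty collection $\mathcal{B}$ of axis-aligned boxes in $\mathbb{R}^3$ whose intersection graph is bipartite, has girth at least $g$, and has minimum degree at least $d$.
   Context: An axis-aligned box in $\mathbb{R}^3$ is a set of the form $[a_1,b_1]\times[a_2,b_2]\times[a_3,b_3]$ with real numbers $a_i\le b_i$. The intersection graph of a collection of sets is the simple graph whose vertices are the sets of the collection, two distinct sets being adjacent if and only if they have non-empty intersection. The girth of a graph is the length of its shortest cycle ($\infty$ if the graph has no cycle). -}

module Defs where

open import Level using (Level; 0ℓ; _⊔_) renaming (suc to lsuc)
open import Data.Bool.Base using (Bool)
open import Data.Fin.Base using (Fin; zero; suc; inject₁; fromℕ)
open import Data.List.Base using (List; length)
open import Data.List.Membership.Propositional using () renaming (_∈_ to _∈ₗ_)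
open import Data.List.Relation.Unary.Unique.Propositional using (Unique)
open import Data.Nat.Base as ℕ using (ℕ; NonZero)
open import Data.Product.Base using (Σ; ∃; ∃-syntax; _×_; _,_)
open import Data.Rational.Base as ℚ using (ℚ)
open import Data.Sum.Base using (_⊎_)
open import Function.Bundles using (_⇔_)
open import Function.Definitions using (Injective)
open import Relation.Binary.Core using (Rel)
open import Relation.Binary.Definitions using (Symmetric; Irreflexive)
open import Relation.Binary.PropositionalEquality.Core using (_≡_; _≢_; sym)
open import Relation.Nullary.Construct.Add.Supremum using (_⁺; [_]; ⊤⁺)
open import Relation.Nullary.Negation.Core using (¬_)
open import Relation.Unary using (Pred; _∈_; _⊆_; _≐_; _≬_)

private
  variable
    v e : Level

------------------------------------------------------------------------
-- Real numbers, as two-sided Dedekind cuts of ℚ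

record ℝ : Set₁ where
  field
    lower           : Pred ℚ 0ℓ
    upper           : Pred ℚ 0ℓ
    lower-inhabited : ∃[ q ] q ∈ lower
    upper-inhabited : ∃[ q ] q ∈ upper
    lower-rounded   : ∀ q → q ∈ lower ⇔ (∃[ r ] (q ℚ.< r × r ∈ lower))
    upper-rounded   : ∀ q → q ∈ upper ⇔ (∃[ r ] (r ℚ.< q × r ∈ upper))
    disjoint        : ∀ q → ¬ (q ∈ lower × q ∈ upper)
    located         : ∀ q r → q ℚ.< r → q ∈ lower ⊎ r ∈ upper

infix 4 _≤ᵣ_

_≤ᵣ_ : Rel ℝ 0ℓ
x ≤ᵣ y = ℝ.lower x ⊆ ℝ.lower y

------------------------------------------------------------------------
-- Axis-aligned boxes in ℝⁿ

Point : ℕ → Set₁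
Point n = Fin n → ℝ

record Box (n : ℕ) : Set₁ where
  field
    a b : Fin n → ℝ
    a≤b : ∀ k → a k ≤ᵣ b k

⟦_⟧ : ∀ {n} → Box n → Pred (Point n) 0ℓ
⟦ B ⟧ p = ∀ k → Box.a B k ≤ᵣ p k × p k ≤ᵣ Box.b B k

-- Members are pairwise distinct as sets of points, so that indices
-- stand for the sets of the collection without repetition.
record BoxCollection (n : ℕ) : Set₁ where
  field
    size     : ℕ
    box      : Fin size → Box n
    distinct : Injective _≡_ _≐_ (λ i → ⟦ box i ⟧)

NonEmpty : ∀ {n} → BoxCollection n → Set
NonEmpty 𝓑 = NonZero (BoxCollection.size 𝓑)

------------------------------------------------------------------------
-- Simple graphs

record Graph (v e : Level) : Set (lsuc (v ⊔ e)) where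
  field
    Vertex    : Set v
    Adj       : Rel Vertex e
    symmetric : Symmetric Adj
    loopless  : Irreflexive _≡_ Adj

intersectionGraph : ∀ {n} → BoxCollection n → Graph 0ℓ (lsuc 0ℓ)
intersectionGraph 𝓑 = record
  { Vertex    = Fin size
  ; Adj       = λ i j → i ≢ j × ⟦ box i ⟧ ≬ ⟦ box j ⟧
  ; symmetric = λ (i≢j , p , p∈i , p∈j) → (λ j≡i → i≢j (sym j≡i)) , p , p∈j , p∈i
  ; loopless  = λ i≡j (i≢j , _) → i≢j i≡j
  }
  where open BoxCollection 𝓑

module _ (G : Graph v e) where
  open Graph G

  Bipartite : Set (v ⊔ e)
  Bipartite = ∃ λ (side : Vertex → Bool) → ∀ x y → Adj x y → side x ≢ side y

  -- A cycle x₀ x₁ … xₘ x₀, of length m + 1 ≥ 3.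
  record Cycle : Set (v ⊔ e) where
    field
      m        : ℕ
      2≤m      : 2 ℕ.≤ m
      vertex   : Fin (ℕ.suc m) → Vertex
      distinct : Injective _≡_ _≡_ vertex
      step     : ∀ (i : Fin m) → Adj (vertex (inject₁ i)) (vertex (suc i))
      close    : Adj (vertex (fromℕ m)) (vertex zero)

  cycleLength : Cycle → ℕ
  cycleLength c = ℕ.suc (Cycle.m c)

  -- ℕ ⁺ is ℕ with a greatest element ⊤⁺ = ∞ adjoined.
  IsGirth : ℕ ⁺ → Set (v ⊔ e)
  IsGirth [ k ] = (∃[ c ] cycleLength c ≡ k) × (∀ c → k ℕ.≤ cycleLength c)
  IsGirth ⊤⁺    = ¬ Cycle

  -- The list enumerates the neighbours of x without repetition.
  IsDegree : Vertex → ℕ → Set (v ⊔ e)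
  IsDegree x k = Σ (List Vertex) λ ys →
    Unique ys × (∀ y → y ∈ₗ ys ⇔ Adj x y) × length ys ≡ k

  IsMinDegree : ℕ → Set (v ⊔ e)
  IsMinDegree δ =
    (∃[ x ] IsDegree x δ) × (∀ x → ∃[ k ] (IsDegree x k × δ ℕ.≤ k))

{-# OPTIONS --safe #-}
module Submission where

-- Represent a point p of the plane by a vertical line segment over p and a
-- rectangle by a horizontal slab at a height of its own: then the boxes of ℝ³
-- intersect exactly as the points and rectangles are incident.  It suffices to
-- find points and rectangles of large girth, every rectangle containing d points
-- and every point lying in d rectangles.
--
-- Induct on the number t of rectangles through each point.  Given such an
-- arrangement with point set P, take a bipartite graph of large girth between L
-- and P × R, in which every l ∈ L has exactly one neighbour in {p} × R for each
-- p, and every (p , r) has d neighbours.  Stack a flat copy of the arrangement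
-- for each l ∈ L, and move the points horizontally, keeping their order within
-- each copy, so that all points (l , p) with (p , r) a neighbour of l lie in a
-- vertical strip of their own.  These strips are the new rectangles.
--
-- The bipartite graphs come from iterated lifts: in the lift of a graph over the
-- group (ℤ/2)^edges a closed walk uses every edge an even number of times, which
-- a shortest closed walk of the base graph does not, so the girth increases.

open import Defs
open import Level using (0ℓ)
open import Data.Bool.Base using (Bool; true; false; not)
open import Data.Bool.Properties using (not-involutive; not-¬)
open import Data.Empty using (⊥)
open import Data.Fin.Base using (Fin; zero; suc; toℕ; inject₁; fromℕ)
open import Data.Fin.Patterns using (0F; 1F; 2F)
import Data.Fin.Properties as Fin
open import Data.Fin.Relation.Unary.Top using (view; ‵fromℕ; ‵inject₁)
import Data.Integer.Base as ℤ
import Data.Integer.Properties as ℤ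
open import Data.List.Base using (List; length; filter; allFin)
open import Data.List.Extrema.Nat using (argmin; f[argmin]≤f[xs])
open import Data.List.Membership.Propositional using () renaming (_∈_ to _∈ₗ_)
open import Data.List.Membership.Propositional.Properties
  using (∈-filter⁺; ∈-filter⁻; ∈-allFin)
import Data.List.Membership.Setoid.Properties as Membership
import Data.List.Relation.Unary.All as All
import Data.List.Relation.Unary.Any as Any
open import Data.List.Relation.Unary.Unique.Propositional.Properties using (filter⁺; allFin⁺)
open import Data.Nat.Base
  using (ℕ; zero; suc; _+_; _*_; _⊔_; _≤_; _<_; z≤n; s≤s; s≤s⁻¹)
import Data.Nat.Coprimality as Coprimality
open import Data.Nat.Properties
open import Data.Product.Base using (Σ; ∃; _×_; _,_; proj₁; proj₂; uncurry; swap)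
open import Data.Product.Function.NonDependent.Propositional using (_×-↔_)
open import Data.Product.Properties using (,-injectiveˡ; ,-injectiveʳ)
open import Data.Rational.Base as ℚ using (ℚ; mkℚ; *≤*; 1ℚ)
import Data.Rational.Properties as ℚ
open import Data.Sum.Base using (_⊎_; inj₁; inj₂)
open import Data.Sum.Function.Propositional using (_⊎-↔_)
open import Data.Sum.Properties using (inj₁-injective; inj₂-injective)
open import Data.Unit.Base using (⊤; tt)
open import Data.Vec.Base using (Vec; []; _∷_; lookup; tabulate; updateAt; replicate)
open import Data.Vec.Properties
  using (lookup∘tabulate; lookup∘updateAt; lookup∘updateAt′; updateAt-id-local; updateAt-updateAt)
open import Function.Base using (_∘_; id)
open import Function.Bundles using (_↔_; Injection; Inverse; mk⇔; mk↔ₛ′)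
open import Function.Construct.Composition using (_↔-∘_)
open import Function.Construct.Symmetry using (↔-sym)
open import Function.Definitions using (Injective)
open import Function.Properties.Inverse using (↔⇒↣)
open import Relation.Binary.Construct.Add.Supremum.NonStrict _≤_ using (_≤⁺_; [_]; _≤⊤⁺)
open import Relation.Binary.Core using (Rel)
open import Relation.Binary.Definitions using (DecidableEquality; Symmetric; Irreflexive)
import Relation.Binary.Definitions as Binary
open import Relation.Binary.PropositionalEquality
  using (_≡_; _≢_; refl; sym; trans; cong; cong₂; subst; subst₂; setoid)
open import Relation.Nullary using (¬_; Dec; yes; no; contradiction)
open import Relation.Nullary.Construct.Add.Supremum using (_⁺; [_]; ⊤⁺)
open import Relation.Nullary.Decidable using (map′; _×-dec_; _→-dec_)
open import Relation.Unary using (Decidable; _≐_; _≬_; _⊆′_)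

-- Finite sets

Finite : Set → Set
Finite A = ∃ λ n → A ↔ Fin n

module _ {A : Set} (A-finite : Finite A) where

  code : A → Fin (proj₁ A-finite)
  code = Inverse.to (proj₂ A-finite)

  code-injective : Injective _≡_ _≡_ code
  code-injective = Injection.injective (↔⇒↣ (proj₂ A-finite))

  finite⇒≟ : DecidableEquality A
  finite⇒≟ = Fin.inj⇒≟ (↔⇒↣ (proj₂ A-finite))

Fin-finite : ∀ n → Finite (Fin n)
Fin-finite n = n , mk↔ₛ′ id id (λ _ → refl) (λ _ → refl)

_×-finite_ : ∀ {A B} → Finite A → Finite B → Finite (A × B)
(_ , A↔) ×-finite (_ , B↔) = _ , ↔-sym Fin.*↔× ↔-∘ (A↔ ×-↔ B↔)

_⊎-finite_ : ∀ {A B} → Finite A → Finite B → Finite (A ⊎ B)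
(_ , A↔) ⊎-finite (_ , B↔) = _ , ↔-sym Fin.+↔⊎ ↔-∘ (A↔ ⊎-↔ B↔)

⊤-finite : Finite ⊤
⊤-finite = 1 , ↔-sym Fin.1↔⊤

⊥-finite : Finite ⊥
⊥-finite = 0 , ↔-sym Fin.0↔⊥

bits-finite : ∀ n → Finite (Vec Bool n)
bits-finite zero    = 1 , mk↔ₛ′ (λ _ → zero) (λ _ → []) (λ { zero → refl }) (λ { [] → refl })
bits-finite (suc n) with m , V↔ ← (_ , ↔-sym Fin.2↔Bool) ×-finite bits-finite n =
  m , V↔ ↔-∘ uncons↔
  where
  uncons↔ : Vec Bool (suc n) ↔ (Bool × Vec Bool n)
  uncons↔ = mk↔ₛ′ (λ { (b ∷ bs) → b , bs }) (uncurry _∷_) (λ _ → refl) (λ { (_ ∷ _) → refl })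

-- Walks and girth in incidence graphs

-- A walk of length m traverses m blocks; its first block is recorded in the
-- type so that two walks can be joined without backtracking.
data Walk {P Q : Set} (I : P → Q → Set) : P → Q → P → ℕ → Set where
  single : ∀ {p q p′} → I p q → I p′ q → p ≢ p′ → Walk I p q p′ 1
  cons   : ∀ {p q p₁ q₁ p′ m} → I p q → I p₁ q → p ≢ p₁ → q ≢ q₁ →
           Walk I p₁ q₁ p′ m → Walk I p q p′ (suc m)

walk-start : ∀ {P Q I p q p′ m} → Walk {P} {Q} I p q p′ m → I p q
walk-start (single p∈q _ _)   = p∈q
walk-start (cons p∈q _ _ _ _) = p∈q

-- Closed walks need not be reduced at their base point.  Every cycle of the
-- incidence graph of length 2m is a closed walk of length m.
Girth≥ : {P Q : Set} → (P → Q → Set) → ℕ → Set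
Girth≥ I g = ∀ {p q m} → Walk I p q p m → g ≤ m

-- Port graphs of large girth

PortIncidence : {A L R : Set} → (A → L → R) → L → A × R → Set
PortIncidence f l (i , r) = f i l ≡ r

-- A bipartite graph between L and A × R in which l has one edge for each port
-- i ∈ A, leading to (i , neighbour i l).  Fixing L = Fin k × R makes it possible
-- for each neighbour i to have all its fibres of size k.
record PortGraph (A : Set) (k g : ℕ) : Set₁ where
  field
    R          : Set
    R-finite   : Finite R
    neighbour  : A → Fin k × R → R
    preimage   : A → Fin k → R → R
    neighbour-preimage : ∀ i c r → neighbour i (c , preimage i c r) ≡ r
    girth      : Girth≥ (PortIncidence neighbour) g
    inhabitant : R

  L : Set
  L = Fin k × R

  L-finite : Finite L
  L-finite = Fin-finite k ×-finite R-finite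

-- Lifts of port graphs over bit vectors

module Lift {A : Set} (A-finite : Finite A) {k g : ℕ} (G : PortGraph A k g) where
  open PortGraph G

  private
    edges : Finite (L × A)
    edges = L-finite ×-finite A-finite

    Bits : Set
    Bits = Vec Bool (proj₁ edges)

    toggle : L × A → Bits → Bits
    toggle e S = updateAt S (code edges e) not

    bit : L × A → Bits → Bool
    bit e S = lookup S (code edges e)

    toggle-involutive : ∀ e S → toggle e (toggle e S) ≡ S
    toggle-involutive e S = trans (updateAt-updateAt (code edges e) S)
      (updateAt-id-local (code edges e) S (not-involutive _))

    bit-toggle : ∀ e S → bit e (toggle e S) ≡ not (bit e S)
    bit-toggle e S = lookup∘updateAt (code edges e) S

    bit-toggle′ : ∀ {e e′} → e ≢ e′ → ∀ S → bit e (toggle e′ S) ≡ bit e S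
    bit-toggle′ e≢e′ S = lookup∘updateAt′ _ _ (e≢e′ ∘ code-injective edges) S

    _≟A_ = finite⇒≟ A-finite
    _≟L_ = finite⇒≟ L-finite

    -- `S` names the sheet of a left vertex; each of its edges leads to the sheet with the bit of
    -- that edge flipped.
    lifted : A → Fin k × (R × Bits) → R × Bits
    lifted i (c , r , S) = neighbour i (c , r) , toggle ((c , r) , i) S

    base : Fin k × (R × Bits) → L
    base (c , r , _) = c , r

    bits : Fin k × (R × Bits) → Bits
    bits (_ , _ , S) = S

    I  = PortIncidence neighbour
    I′ = PortIncidence lifted

    baseBlock : A × (R × Bits) → A × R
    baseBlock (i , r , _) = i , r

    incidence : ∀ {x q} → I′ x q → I (base x) (baseBlock q)
    incidence refl = refl

    -- Since `toggle` is an involution, distinct lifts of one edge end in distinct blocks. Together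
    -- with `block-≢` this keeps projected walks reduced.
    base-≢ : ∀ {x y q} → I′ x q → I′ y q → x ≢ y → base x ≢ base y
    base-≢ {c , r , S} {.c , .r , T} {i , _} refl eq x≢y refl = x≢y (cong (λ S → c , r , S)
      (trans (sym (toggle-involutive e S))
        (trans (cong (toggle e) (sym (cong proj₂ eq))) (toggle-involutive e T))))
      where e = (c , r) , i

    block-≢ : ∀ {x q q′} → I′ x q → I′ x q′ → q ≢ q′ → baseBlock q ≢ baseBlock q′
    block-≢ refl refl q≢q′ refl = q≢q′ refl

    project : ∀ {x q y m} → Walk I′ x q y m → Walk I (base x) (baseBlock q) (base y) m
    project {q = q} (single x∈q y∈q x≢y) =
      single (incidence {q = q} x∈q) (incidence {q = q} y∈q) (base-≢ {q = q} x∈q y∈q x≢y)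
    project {q = q} (cons {q₁ = q₁} x∈q y∈q x≢y q≢q₁ w) =
      cons (incidence {q = q} x∈q) (incidence {q = q} y∈q) (base-≢ {q = q} x∈q y∈q x≢y)
        (block-≢ y∈q (walk-start w) q≢q₁) (project w)

    -- Passing through a block changes at most the bits of the two edges used.
    bit-constant : ∀ {x y i s e} → I′ x (i , s) → I′ y (i , s) →
      e ≢ (base x , i) → e ≢ (base y , i) → bit e (bits x) ≡ bit e (bits y)
    bit-constant {_ , _ , S} {_ , _ , T} {e = e} refl eq e≢x e≢y = trans (sym (bit-toggle′ e≢x S))
      (trans (cong (bit e) (sym (cong proj₂ eq))) (bit-toggle′ e≢y T))

    bit-changes : ∀ {x y i s} → I′ x (i , s) → I′ y (i , s) → base x ≢ base y →
      bit (base x , i) (bits x) ≢ bit (base x , i) (bits y)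
    bit-changes {x@(_ , _ , S)} {_ , _ , T} {i} refl eq x≢y same = not-¬ (sym same)
      (trans (sym (bit-toggle′ (x≢y ∘ ,-injectiveˡ) T))
        (trans (cong (bit (base x , i)) (cong proj₂ eq)) (bit-toggle (base x , i) S)))

    -- The rest of a shortest closed walk after its first edge (l₀, i₁), which
    -- led to l₁.  It can only use that edge again by ending with it, and then
    -- a shorter closed walk through l₁ exists.
    rest : ∀ {x q y m l₁ i₁} → Walk I′ x q y m → m < g →
      l₁ ≢ base y → neighbour i₁ l₁ ≡ neighbour i₁ (base y) →
      bit (base y , i₁) (bits x) ≡ bit (base y , i₁) (bits y)
      ⊎ (∃ λ m′ → m′ ≤ m × Walk I (base x) (baseBlock q) l₁ m′)
      ⊎ (base x ≡ l₁ × proj₁ q ≡ i₁)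
    rest {x} {q@(i , _)} {y} {l₁ = l₁} {i₁} (single x∈q y∈q x≢y) m<g l₁≢y same
      with i ≟A i₁ | base x ≟L l₁
    ... | no i≢i₁   | _        = inj₁ (bit-constant {x} {y} x∈q y∈q
      (i≢i₁ ∘ sym ∘ ,-injectiveʳ) (i≢i₁ ∘ sym ∘ ,-injectiveʳ))
    ... | yes i≡i₁  | yes x≡l₁ = inj₂ (inj₂ (x≡l₁ , i≡i₁))
    -- `l₁` lies on this last block too, so the walk can end there instead.
    ... | yes refl  | no x≢l₁  = inj₂ (inj₁ (1 , ≤-refl ,
      single (incidence {q = q} x∈q) (trans same (incidence {q = q} y∈q)) x≢l₁))
    rest {x} {q} {y} {suc m} w@(cons {p₁ = z} {q₁ = q₁} x∈q z∈q x≢z q≢q₁ w′) m<g l₁≢y same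
      with rest w′ (<-trans (n<1+n m) m<g) l₁≢y same
    -- The tracked edge starts at `base y`. Visiting `base y` before the end would project to a
    -- closed walk shorter than `g`, so this passage does not use that edge.
    ... | inj₁ eq = inj₁ (trans
      (bit-constant {x} {z} x∈q z∈q (avoid w m<g ∘ ,-injectiveˡ)
        (avoid w′ (<-trans (n<1+n m) m<g) ∘ ,-injectiveˡ))
      eq)
      where
      avoid : ∀ {x q m} → Walk I′ x q y m → m < g → base y ≢ base x
      avoid w m<g y≡x = <⇒≱ m<g
        (girth (subst (λ l → Walk I l _ (base y) _) (sym y≡x) (project w)))
    ... | inj₂ (inj₁ (m′ , m′≤m , v)) = inj₂ (inj₁ (suc m′ , s≤s m′≤m ,
      cons (incidence {q = q} x∈q) (incidence {q = q} z∈q) (base-≢ {q = q} x∈q z∈q x≢z)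
        (block-≢ z∈q (walk-start w′) q≢q₁) v))
    ... | inj₂ (inj₂ (refl , _)) = inj₂ (inj₁ (1 , s≤s z≤n ,
      single (incidence {q = q} x∈q) (incidence {q = q} z∈q) (base-≢ {q = q} x∈q z∈q x≢z)))

    -- The first passage flips the bit of its first edge, which must be restored. By `rest`, either
    -- it never is, or the base graph has a closed walk shorter than `g`, or the second block equals
    -- the first.
    closed-walk-longer : ∀ {x q m} → Walk I′ x q x m → m ≢ g
    closed-walk-longer (single _ _ x≢x) _ = x≢x refl
    closed-walk-longer {x} {q} {suc m} (cons {p₁ = y} {q₁ = q₁} x∈q y∈q x≢y q≢q₁ w) refl
      with rest w ≤-refl (base-≢ {q = q} x∈q y∈q x≢y ∘ sym)
             (trans (incidence {q = q} y∈q) (sym (incidence {q = q} x∈q)))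
    ... | inj₁ eq = bit-changes {x} {y} x∈q y∈q (base-≢ {q = q} x∈q y∈q x≢y) (sym eq)
    ... | inj₂ (inj₁ (m′ , m′≤m , v)) = <⇒≱ (s≤s m′≤m) (girth v)
    ... | inj₂ (inj₂ (_ , refl)) = q≢q₁ (cong (_ ,_) (trans (sym y∈q) (walk-start w)))

  lift : PortGraph A k (suc g)
  lift = record
    { R          = R × Bits
    ; R-finite   = R-finite ×-finite bits-finite _
    ; neighbour  = lifted
    ; preimage   = λ i c (r , S) →
        preimage i c r , toggle ((c , preimage i c r) , i) S
    ; neighbour-preimage = λ i c (r , S) →
        cong₂ _,_ (neighbour-preimage i c r) (toggle-involutive _ S)
    ; girth      = λ w → ≤∧≢⇒< (girth (project w)) (closed-walk-longer w ∘ sym)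
    ; inhabitant = inhabitant , replicate _ false
    }

-- Girth at least `0` asks nothing, so one right vertex per port is a start; each lift raises the
-- bound by one.
portGraph : ∀ {A} → Finite A → ∀ k g → PortGraph A k g
portGraph A-finite k zero    = record
  { R = ⊤ ; R-finite = ⊤-finite ; neighbour = _ ; preimage = _
  ; neighbour-preimage = λ _ _ _ → refl ; girth = λ _ → z≤n ; inhabitant = tt }
portGraph A-finite k (suc g) = Lift.lift A-finite (portGraph A-finite k g)

-- Arrangements of points and half-open rectangles

-- Coordinates will have the form `b * n + v` with last digit `v < n`; comparison with a multiple of
-- `n` sees only `b`.
*-digit-≤ : ∀ {a b n v} → v < n → a * n ≤ b * n + v → a ≤ b
*-digit-≤ {a} {b} {n} {v} v<n le = s≤s⁻¹ (*-cancelʳ-< n a (suc b) (begin-strict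
  a * n     ≤⟨ le ⟩
  b * n + v <⟨ +-monoʳ-< (b * n) v<n ⟩
  b * n + n ≡⟨ +-comm (b * n) n ⟩
  suc b * n ∎))
  where open ≤-Reasoning

*-digit-< : ∀ {a b n v} → b * n + v < a * n → b < a
*-digit-< {a} {b} {n} {v} lt = *-cancelʳ-< n b a (≤-<-trans (m≤m+n (b * n) v) lt)

≤-*-digit : ∀ {a b} n v → a ≤ b → a * n ≤ b * n + v
≤-*-digit {a} {b} n v a≤b = ≤-trans (*-monoˡ-≤ n a≤b) (m≤m+n (b * n) v)

<-*-digit : ∀ {a b n v} → v < n → b < a → b * n + v < a * n
<-*-digit {a} {b} {n} {v} v<n b<a = begin-strict
  b * n + v <⟨ +-monoʳ-< (b * n) v<n ⟩
  b * n + n ≡⟨ +-comm (b * n) n ⟩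
  suc b * n ≤⟨ *-monoˡ-≤ n b<a ⟩
  a * n     ∎
  where open ≤-Reasoning

digit-injective : ∀ {a b n u v} → u < n → v < n → a * n + u ≡ b * n + v → a ≡ b × u ≡ v
digit-injective {a} {b} {n} {u} {v} u<n v<n eq = a≡b , u≡v a≡b
  where
  a≡b : a ≡ b
  a≡b = ≤-antisym
    (*-digit-≤ v<n (≤-trans (m≤m+n (a * n) u) (≤-reflexive eq)))
    (*-digit-≤ u<n (≤-trans (m≤m+n (b * n) v) (≤-reflexive (sym eq))))
  u≡v : a ≡ b → u ≡ v
  u≡v refl = +-cancelˡ-≡ (a * n) u v eq

infix 4 _∈[_,_⟩

_∈[_,_⟩ : ℕ → ℕ → ℕ → Set
x ∈[ a , b ⟩ = a ≤ x × x < b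

-- `x-injective` lets a strip single out one point, and `height` is the offset at which copies can
-- be stacked.
record Arrangement (k g t : ℕ) : Set₁ where
  field
    P Q            : Set
    P-finite       : Finite P
    Q-finite       : Finite Q
    x y            : P → ℕ
    x-injective    : Injective _≡_ _≡_ x
    left right     : Q → ℕ
    bottom top     : Q → ℕ
    height         : ℕ
    y<height       : ∀ p → y p < height
    top≤height     : ∀ q → top q ≤ height

  _∈ᴿ_ : P → Q → Set
  p ∈ᴿ q = x p ∈[ left q , right q ⟩ × y p ∈[ bottom q , top q ⟩

  field
    points     : ∀ q → Σ (Fin k → P) λ h → Injective _≡_ _≡_ h × (∀ c → h c ∈ᴿ q)
    rectangles : ∀ p → Σ (Fin t → Q) λ h → Injective _≡_ _≡_ h × (∀ c → p ∈ᴿ h c)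
    girth      : Girth≥ _∈ᴿ_ g
    point      : P

-- Copies of an arrangement are stacked vertically, one for each left vertex l
-- of a port graph whose ports are the points p.  Only the order of the
-- x-coordinates within a copy matters, so the copy (l , p) of p can be moved
-- into a vertical strip reserved for the right vertex (p , neighbour p l).
module Extend {k g t : ℕ} (𝓐 : Arrangement (suc k) g t)
              (G : PortGraph (Arrangement.P 𝓐) (suc k) g) where
  open Arrangement 𝓐 hiding (point; girth; points; rectangles)
  private
    module 𝓐 = Arrangement 𝓐
    module G = PortGraph G
    open G using (L; R; neighbour)

    #L #R : ℕ
    #L = proj₁ G.L-finite
    #R = proj₁ G.R-finite

    codeL : L → ℕ
    codeL l = toℕ (code G.L-finite l)

    codeR : R → ℕ
    codeR r = toℕ (code G.R-finite r)

    codeL< : ∀ l → codeL l < #L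
    codeL< l = Fin.toℕ<n (code G.L-finite l)

    codeR< : ∀ r → codeR r < #R
    codeR< r = Fin.toℕ<n (code G.R-finite r)

    P′ Q′ : Set
    P′ = L × P
    Q′ = (L × Q) ⊎ (P × R)

    -- Of the three digits of `x′`, the first keeps the order of the points in each copy, the second
    -- selects the strip, the last separates the copies within a strip.
    x′ y′ : P′ → ℕ
    x′ (l , p) = (x p * #R + codeR (neighbour p l)) * #L + codeL l
    y′ (l , p) = codeL l * height + y p

    -- An old rectangle bounds the first digit and stays in its layer; a new one fixes the first two
    -- digits and spans all layers.
    left′ right′ bottom′ top′ : Q′ → ℕ
    left′ (inj₁ (l , q)) = left q * #R * #L
    left′ (inj₂ (p , r)) = (x p * #R + codeR r) * #L
    right′ (inj₁ (l , q)) = right q * #R * #L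
    right′ (inj₂ (p , r)) = suc (x p * #R + codeR r) * #L
    bottom′ (inj₁ (l , q)) = codeL l * height + bottom q
    bottom′ (inj₂ (p , r)) = 0
    top′ (inj₁ (l , q)) = codeL l * height + top q
    top′ (inj₂ (p , r)) = #L * height

    x′-injective : Injective _≡_ _≡_ x′
    x′-injective {l , p} {l′ , p′} eq
      with strip , l≡l′ ← digit-injective (codeL< l) (codeL< l′) eq
      with p≡p′ , _ ← digit-injective (codeR< (neighbour p l)) (codeR< (neighbour p′ l′)) strip
      = cong₂ _,_ (code-injective G.L-finite (Fin.toℕ-injective l≡l′)) (x-injective p≡p′)

    y′<height : ∀ p → y′ p < #L * height
    y′<height (l , p) = <-*-digit (y<height p) (codeL< l)

    top′≤height : ∀ q → top′ q ≤ #L * height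
    top′≤height (inj₁ (l , q)) = begin
      codeL l * height + top q  ≤⟨ +-monoʳ-≤ (codeL l * height) (top≤height q) ⟩
      codeL l * height + height ≡⟨ +-comm (codeL l * height) height ⟩
      suc (codeL l) * height    ≤⟨ *-monoˡ-≤ height (codeL< l) ⟩
      #L * height               ∎
      where open ≤-Reasoning
    top′≤height (inj₂ _) = ≤-refl

    _∈′_ : P′ → Q′ → Set
    p ∈′ q = x′ p ∈[ left′ q , right′ q ⟩ × y′ p ∈[ bottom′ q , top′ q ⟩

    old-∈ : ∀ {l p q} → p ∈ᴿ q → (l , p) ∈′ inj₁ (l , q)
    old-∈ {l} {p} ((l≤x , x<r) , (b≤y , y<t)) =
      (≤-*-digit #L _ (≤-*-digit #R _ l≤x) ,
       <-*-digit (codeL< l) (<-*-digit (codeR< (neighbour p l)) x<r)) ,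
      (+-monoʳ-≤ (codeL l * height) b≤y , +-monoʳ-< (codeL l * height) y<t)

    -- The layers are disjoint, so `y′` determines the copy.
    old-∈⁻ : ∀ l p l′ q → (l , p) ∈′ inj₁ (l′ , q) → l ≡ l′ × p ∈ᴿ q
    old-∈⁻ l p l′ q ((l≤x , x<r) , (b≤y , y<t)) =
      l≡l′ , (*-digit-≤ (codeR< (neighbour p l)) (*-digit-≤ (codeL< l) l≤x) ,
              *-digit-< {n = #R} (*-digit-< {n = #L} x<r)) ,
      same-copy l≡l′
      where
      cl≤cl′ : codeL l ≤ codeL l′
      cl≤cl′ = s≤s⁻¹ (*-digit-< {n = height} (<-≤-trans y<t (begin
        codeL l′ * height + top q  ≤⟨ +-monoʳ-≤ (codeL l′ * height) (top≤height q) ⟩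
        codeL l′ * height + height ≡⟨ +-comm (codeL l′ * height) height ⟩
        suc (codeL l′) * height    ∎)))
        where open ≤-Reasoning
      cl′≤cl : codeL l′ ≤ codeL l
      cl′≤cl = *-digit-≤ (y<height p) (≤-trans (m≤m+n _ (bottom q)) b≤y)
      l≡l′ : l ≡ l′
      l≡l′ = code-injective G.L-finite (Fin.toℕ-injective (≤-antisym cl≤cl′ cl′≤cl))
      same-copy : l ≡ l′ → y p ∈[ bottom q , top q ⟩
      same-copy refl = +-cancelˡ-≤ (codeL l * height) _ _ b≤y ,
                       +-cancelˡ-< (codeL l * height) _ _ y<t

    new-∈ : ∀ {l p r} → neighbour p l ≡ r → (l , p) ∈′ inj₂ (p , r)
    new-∈ {l} {p} refl =
      (m≤m+n (strip * #L) (codeL l) , <-*-digit {suc strip} (codeL< l) ≤-refl) ,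
      (z≤n , y′<height (l , p))
      where
      strip : ℕ
      strip = x p * #R + codeR (neighbour p l)

    new-∈⁻ : ∀ l p p′ r → (l , p) ∈′ inj₂ (p′ , r) → p ≡ p′ × neighbour p l ≡ r
    new-∈⁻ l p p′ r ((l≤x , x<r) , _)
      with p≡p′ , r≡r′ ← digit-injective (codeR< (neighbour p l)) (codeR< r)
             (≤-antisym (s≤s⁻¹ (*-digit-< {n = #L} x<r)) (*-digit-≤ (codeL< l) l≤x))
      = x-injective p≡p′ , code-injective G.R-finite (Fin.toℕ-injective r≡r′)

    points′ : ∀ q → Σ (Fin (suc k) → P′) λ h → Injective _≡_ _≡_ h × (∀ c → h c ∈′ q)
    points′ (inj₁ (l , q)) with h , h-inj , h-in ← 𝓐.points q =
      (λ c → l , h c) , h-inj ∘ ,-injectiveʳ , (λ c → old-∈ (h-in c))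
    -- One copy of `p` for each preimage of `r`; their `Fin` components differ.
    points′ (inj₂ (p , r)) =
      (λ c → (c , G.preimage p c r) , p) ,
      ,-injectiveˡ ∘ ,-injectiveˡ ,
      (λ c → new-∈ (G.neighbour-preimage p c r))

    rectangles′ : ∀ p → Σ (Fin (suc t) → Q′) λ h → Injective _≡_ _≡_ h × (∀ c → p ∈′ h c)
    rectangles′ (l , p) with h , h-inj , h-in ← 𝓐.rectangles p =
      h′ , h′-inj , λ { zero → new-∈ refl ; (suc c) → old-∈ (h-in c) }
      where
      h′ : Fin (suc t) → Q′
      h′ zero    = inj₂ (p , neighbour p l)
      h′ (suc c) = inj₁ (l , h c)
      h′-inj : Injective _≡_ _≡_ h′
      h′-inj {zero}  {zero}  _  = refl
      h′-inj {suc c} {suc d} eq = cong suc (h-inj (,-injectiveʳ (inj₁-injective eq)))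

    CopyWalk = Walk _∈ᴿ_
    PortWalk = Walk (PortIncidence neighbour)

    -- Contracting every copy turns a walk into a walk of the port graph.  It
    -- does not backtrack there, because a stay in a copy that is shorter than
    -- the girth leads to a different point.
    Contraction : P′ → Q′ → P′ → ℕ → Set
    Contraction (l , p) (inj₁ (_ , q)) (l′ , p′) m =
      (l ≡ l′ × CopyWalk p q p′ m)
      ⊎ (∃ λ p₁ → ∃ λ a → ∃ λ s →
          a + s ≤ m × CopyWalk p q p₁ a × PortWalk l (p₁ , neighbour p₁ l) l′ s)
    Contraction (l , p) (inj₂ _) (l′ , _) m =
      ∃ λ s → s ≤ m × PortWalk l (p , neighbour p l) l′ s

    contract : ∀ {v q v′ m} → m < g → Walk _∈′_ v q v′ m → Contraction v q v′ m
    contract {l , p} {inj₁ (l₀ , q)} {l′ , p′} _ (single v∈q v′∈q v≢v′)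
      with refl , p∈q ← old-∈⁻ l p l₀ q v∈q | refl , p′∈q ← old-∈⁻ l′ p′ l₀ q v′∈q
      = inj₁ (refl , single p∈q p′∈q (v≢v′ ∘ cong (l ,_)))
    contract {l , p} {inj₂ (p₀ , r)} {l′ , p′} _ (single v∈q v′∈q v≢v′)
      with refl , refl ← new-∈⁻ l p p₀ r v∈q | refl , r≡ ← new-∈⁻ l′ p′ p₀ r v′∈q
      = 1 , ≤-refl , single refl r≡ (v≢v′ ∘ cong (_, p))
    contract {l , p} {inj₁ (l₀ , q)} m<g
             (cons {p₁ = l₁ , p₁} {q₁ = inj₁ (l₂ , q₁)} v∈q v₁∈q v≢v₁ q≢q₁ w)
      with refl , p∈q ← old-∈⁻ l p l₀ q v∈q | refl , p₁∈q ← old-∈⁻ l₁ p₁ l₀ q v₁∈q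
         | refl , _ ← old-∈⁻ l₁ p₁ l₂ q₁ (walk-start w)
      with contract (<-trans (n<1+n _) m<g) w
    ... | inj₁ (refl , u) =
      inj₁ (refl , cons p∈q p₁∈q (v≢v₁ ∘ cong (l ,_)) (q≢q₁ ∘ cong (inj₁ ∘ (l ,_))) u)
    ... | inj₂ (p₂ , a , s , a+s≤m , u , z) =
      inj₂ (p₂ , suc a , s , s≤s a+s≤m ,
        cons p∈q p₁∈q (v≢v₁ ∘ cong (l ,_)) (q≢q₁ ∘ cong (inj₁ ∘ (l ,_))) u , z)
    contract {l , p} {inj₁ (l₀ , q)} m<g
             (cons {p₁ = l₁ , p₁} {q₁ = inj₂ (p₂ , r)} v∈q v₁∈q v≢v₁ _ w)
      with refl , p∈q ← old-∈⁻ l p l₀ q v∈q | refl , p₁∈q ← old-∈⁻ l₁ p₁ l₀ q v₁∈q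
      with s , s≤m , z ← contract (<-trans (n<1+n _) m<g) w
      = inj₂ (p₁ , 1 , s , s≤s s≤m , single p∈q p₁∈q (v≢v₁ ∘ cong (l ,_)) , z)
    -- A point lies in only one strip, so two successive new rectangles would coincide.
    contract {l , p} {inj₂ (p₀ , r)} m<g
             (cons {p₁ = l₁ , p₁} {q₁ = inj₂ (p₂ , r₁)} _ v₁∈q _ q≢q₁ w)
      with refl , refl ← new-∈⁻ l₁ p₁ p₀ r v₁∈q
         | refl , refl ← new-∈⁻ l₁ p₁ p₂ r₁ (walk-start w)
      = contradiction refl q≢q₁
    contract {l , p} {inj₂ (p₀ , r)} {l′ , _} {suc m} m<g
             (cons {p₁ = l₁ , p₁} {q₁ = inj₁ _} v∈q v₁∈q v≢v₁ _ w)
      with refl , refl ← new-∈⁻ l p p₀ r v∈q | refl , r≡ ← new-∈⁻ l₁ p₁ p₀ r v₁∈q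
      with contract (<-trans (n<1+n _) m<g) w
    -- The rest never leaves the copy just entered, so one port step remains.
    ... | inj₁ (refl , _) = 1 , s≤s z≤n , single refl r≡ (v≢v₁ ∘ cong (_, p))
    ... | inj₂ (p₂ , a , s , a+s≤m , u , z) =
      suc s , s≤s (≤-trans (m≤n+m s a) a+s≤m) ,
      cons refl r≡ (v≢v₁ ∘ cong (_, p)) (p≢p₂ u ∘ ,-injectiveˡ) z
      where
      a≤1+m : a ≤ suc m
      a≤1+m = ≤-trans (m≤m+n a s) (≤-trans a+s≤m (n≤1+n m))
      p≢p₂ : ∀ {q} → CopyWalk p q p₂ a → p ≢ p₂
      p≢p₂ u refl = <⇒≱ m<g (≤-trans (𝓐.girth u) a≤1+m)

    -- A closed walk either stays in one copy or contracts to a closed walk of the port graph that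
    -- is no longer.
    no-short : ∀ {v q m} → Walk _∈′_ v q v m → ¬ m < g
    no-short {q = inj₁ _} w m<g with contract m<g w
    ... | inj₁ (_ , u) = <⇒≱ m<g (𝓐.girth u)
    ... | inj₂ (_ , a , s , a+s≤m , _ , z) =
      <⇒≱ m<g (≤-trans (G.girth z) (≤-trans (m≤n+m s a) a+s≤m))
    no-short {q = inj₂ _} w m<g with s , s≤m , z ← contract m<g w =
      <⇒≱ m<g (≤-trans (G.girth z) s≤m)

  extend : Arrangement (suc k) g (suc t)
  extend = record
    { P           = P′
    ; Q           = Q′
    ; P-finite    = G.L-finite ×-finite P-finite
    ; Q-finite    = (G.L-finite ×-finite Q-finite) ⊎-finite (P-finite ×-finite G.R-finite)
    ; x           = x′
    ; y           = y′
    ; x-injective = x′-injective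
    ; left        = left′
    ; right       = right′
    ; bottom      = bottom′
    ; top         = top′
    ; height      = #L * height
    ; y<height    = y′<height
    ; top≤height  = top′≤height
    ; points      = points′
    ; rectangles  = rectangles′
    ; girth       = ≮⇒≥ ∘ no-short
    ; point       = (zero , G.inhabitant) , 𝓐.point
    }

-- For `t = 0` a single point without rectangles will do.
arrangement : ∀ k g t → Arrangement (suc k) g t
arrangement k g zero = record
  { P = ⊤ ; Q = ⊥ ; P-finite = ⊤-finite ; Q-finite = ⊥-finite
  ; x = λ _ → 0 ; y = λ _ → 0 ; x-injective = λ _ → refl
  ; left = λ () ; right = λ () ; bottom = λ () ; top = λ ()
  ; height = 1 ; y<height = λ _ → s≤s z≤n ; top≤height = λ ()
  ; points = λ () ; rectangles = λ _ → (λ ()) , (λ { {()} }) , λ ()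
  ; girth = λ { {q = ()} } ; point = tt }
arrangement k g (suc t) =
  Extend.extend 𝓐 (portGraph (Arrangement.P-finite 𝓐) (suc k) g)
  where 𝓐 = arrangement k g t

-- Boxes with natural coordinates

ℚ⇒ℝ : ℚ → ℝ
ℚ⇒ℝ x = record
  { lower           = λ q → q ℚ.< x
  ; upper           = λ q → x ℚ.< q
  ; lower-inhabited = x ℚ.- 1ℚ , x-1<x
  ; upper-inhabited = x ℚ.+ 1ℚ , x<x+1
  ; lower-rounded   = λ q → mk⇔
      (λ q<x → let r , q<r , r<x = ℚ.<-dense q<x in r , q<r , r<x)
      (λ (_ , q<r , r<x) → ℚ.<-trans q<r r<x)
  ; upper-rounded   = λ q → mk⇔
      (λ x<q → let r , x<r , r<q = ℚ.<-dense x<q in r , r<q , x<r)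
      (λ (_ , r<q , x<r) → ℚ.<-trans x<r r<q)
  ; disjoint        = λ q (q<x , x<q) → ℚ.<-asym q<x x<q
  ; located         = located
  }
  where
  x<x+1 : x ℚ.< x ℚ.+ 1ℚ
  x<x+1 = subst (ℚ._< x ℚ.+ 1ℚ) (ℚ.+-identityʳ x) (ℚ.+-monoʳ-< x (ℚ.positive⁻¹ 1ℚ))
  x-1<x : x ℚ.- 1ℚ ℚ.< x
  x-1<x = subst (x ℚ.- 1ℚ ℚ.<_) (ℚ.+-identityʳ x) (ℚ.+-monoʳ-< x (ℚ.negative⁻¹ (ℚ.- 1ℚ)))
  located : ∀ q r → q ℚ.< r → q ℚ.< x ⊎ x ℚ.< r
  located q r q<r with q ℚ.<? x
  ... | yes q<x = inj₁ q<x
  ... | no  q≮x = inj₂ (ℚ.≤-<-trans (ℚ.≮⇒≥ q≮x) q<r)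

ℚ⇒ℝ-mono-≤ : ∀ {x y} → x ℚ.≤ y → ℚ⇒ℝ x ≤ᵣ ℚ⇒ℝ y
ℚ⇒ℝ-mono-≤ x≤y q<x = ℚ.<-≤-trans q<x x≤y

ℚ⇒ℝ-cancel-≤ : ∀ {x y} → ℚ⇒ℝ x ≤ᵣ ℚ⇒ℝ y → x ℚ.≤ y
ℚ⇒ℝ-cancel-≤ x≤y = ℚ.≮⇒≥ (λ y<x → ℚ.<-irrefl refl (x≤y y<x))

ℕ⇒ℚ : ℕ → ℚ
ℕ⇒ℚ n = mkℚ (ℤ.+ n) 0 (Coprimality.sym (Coprimality.1-coprimeTo n))

ℕ⇒ℝ : ℕ → ℝ
ℕ⇒ℝ n = ℚ⇒ℝ (ℕ⇒ℚ n)

ℕ⇒ℝ-mono-≤ : ∀ {m n} → m ≤ n → ℕ⇒ℝ m ≤ᵣ ℕ⇒ℝ n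
ℕ⇒ℝ-mono-≤ {m} {n} m≤n = ℚ⇒ℝ-mono-≤ (*≤* (ℤ.*-monoʳ-≤-nonNeg (ℤ.+ 1) (ℤ.+≤+ m≤n)))

ℕ⇒ℝ-cancel-≤ : ∀ {m n} → ℕ⇒ℝ m ≤ᵣ ℕ⇒ℝ n → m ≤ n
ℕ⇒ℝ-cancel-≤ {m} {n} m≤n = ℤ.drop‿+≤+ (ℤ.*-cancelʳ-≤-pos (ℤ.+ m) (ℤ.+ n) (ℤ.+ 1)
  (ℚ.drop-*≤* (ℚ⇒ℝ-cancel-≤ m≤n)))

record NatBox (n : ℕ) : Set where
  field
    lo hi : Fin n → ℕ
    lo≤hi : ∀ k → lo k ≤ hi k

open NatBox

natBox : ∀ {n} → NatBox n → Box n
natBox B = record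
  { a   = ℕ⇒ℝ ∘ lo B
  ; b   = ℕ⇒ℝ ∘ hi B
  ; a≤b = λ k → ℕ⇒ℝ-mono-≤ (lo≤hi B k)
  }

Overlap : ∀ {n} → NatBox n → NatBox n → Set
Overlap B C = ∀ k → lo B k ≤ hi C k × lo C k ≤ hi B k

meet⇒overlap : ∀ {n} (B C : NatBox n) → ⟦ natBox B ⟧ ≬ ⟦ natBox C ⟧ → Overlap B C
meet⇒overlap B C (s , s∈B , s∈C) k =
  ℕ⇒ℝ-cancel-≤ (λ {q} → proj₂ (s∈C k) {q} ∘ proj₁ (s∈B k) {q}) ,
  ℕ⇒ℝ-cancel-≤ (λ {q} → proj₂ (s∈B k) {q} ∘ proj₁ (s∈C k) {q})

overlap⇒meet : ∀ {n} (B C : NatBox n) → Overlap B C → ⟦ natBox B ⟧ ≬ ⟦ natBox C ⟧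
-- The common point is the coordinatewise maximum of the lower corners.
overlap⇒meet B C o = (λ k → ℕ⇒ℝ (lo B k ⊔ lo C k)) ,
  (λ k → ℕ⇒ℝ-mono-≤ (m≤m⊔n (lo B k) (lo C k)) ,
         ℕ⇒ℝ-mono-≤ (⊔-lub (lo≤hi B k) (proj₂ (o k)))) ,
  (λ k → ℕ⇒ℝ-mono-≤ (m≤n⊔m (lo B k) (lo C k)) ,
         ℕ⇒ℝ-mono-≤ (⊔-lub (proj₁ (o k)) (lo≤hi C k)))

-- The inclusion is tested on the two extreme corners of `B`.
⊆⇒bounds : ∀ {n} (B C : NatBox n) → ⟦ natBox B ⟧ ⊆′ ⟦ natBox C ⟧ →
  ∀ k → lo C k ≤ lo B k × hi B k ≤ hi C k
⊆⇒bounds B C B⊆C k =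
  ℕ⇒ℝ-cancel-≤ (proj₁ (B⊆C (ℕ⇒ℝ ∘ lo B) (λ k → id , ℕ⇒ℝ-mono-≤ (lo≤hi B k)) k)) ,
  ℕ⇒ℝ-cancel-≤ (proj₂ (B⊆C (ℕ⇒ℝ ∘ hi B) (λ k → ℕ⇒ℝ-mono-≤ (lo≤hi B k) , id) k))

-- Girth and minimum degree of finite graphs

least : ∀ {ℓ} {P : ℕ → Set ℓ} → Decidable P → ∀ N →
  (∃ λ k → P k × (∀ j → P j → k ≤ j)) ⊎ (∀ {j} → j < N → ¬ P j)
least P? zero = inj₂ λ ()
least P? (suc N) with least P? N
... | inj₁ found = inj₁ found
... | inj₂ none with P? N
...   | yes PN = inj₁ (N , PN , λ j Pj → ≮⇒≥ (λ j<N → none j<N Pj))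
...   | no ¬PN = inj₂ λ j<1+N Pj → case-< (m≤n⇒m<n∨m≡n (s≤s⁻¹ j<1+N)) Pj
  where
  case-< : ∀ {j} → j < N ⊎ j ≡ N → ¬ _
  case-< (inj₁ j<N)  = none j<N
  case-< (inj₂ refl) = ¬PN

anyVec? : ∀ {ℓ n} m {P : Vec (Fin n) m → Set ℓ} → Decidable P → Dec (∃ P)
anyVec? zero    P? = map′ ([] ,_) (λ { ([] , p) → p }) (P? [])
anyVec? (suc m) P? = map′ (λ (x , xs , p) → x ∷ xs , p) (λ { (x ∷ xs , p) → x , xs , p })
  (Fin.any? λ x → anyVec? m (λ xs → P? (x ∷ xs)))

module FiniteGraph {e n} {Adj : Rel (Fin n) e} (adj? : Binary.Decidable Adj)
                   (symmetric : Symmetric Adj) (loopless : Irreflexive _≡_ Adj) where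

  private
    G : Graph 0ℓ e
    G = record { Vertex = Fin n ; Adj = Adj ; symmetric = symmetric ; loopless = loopless }

    -- Vertices form a vector, unlike in `Cycle`, so that `anyVec?` can search exhaustively.
    CycleOn : ∀ m → Vec (Fin n) (suc m) → Set e
    CycleOn m xs = 2 ≤ m
      × (∀ i j → lookup xs i ≡ lookup xs j → i ≡ j)
      × (∀ (i : Fin m) → Adj (lookup xs (inject₁ i)) (lookup xs (suc i)))
      × Adj (lookup xs (fromℕ m)) (lookup xs zero)

    cycleOn? : ∀ m → Decidable (CycleOn m)
    cycleOn? m xs = 2 ≤? m
      ×-dec Fin.all? (λ i → Fin.all? λ j → (lookup xs i Fin.≟ lookup xs j) →-dec (i Fin.≟ j))
      ×-dec Fin.all? (λ i → adj? (lookup xs (inject₁ i)) (lookup xs (suc i)))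
      ×-dec adj? (lookup xs (fromℕ m)) (lookup xs zero)

    HasCycle : ℕ → Set e
    HasCycle m = ∃ (CycleOn m)

    toCycle : ∀ {m} → HasCycle m → Cycle G
    toCycle {m} (xs , 2≤m , inj , edges , close) = record
      { m = m ; 2≤m = 2≤m ; vertex = lookup xs ; distinct = inj _ _ ; step = edges ; close = close }

    fromCycle : (c : Cycle G) → HasCycle (Cycle.m c)
    fromCycle c = tabulate vertex , 2≤m ,
      (λ i j eq → distinct (trans (sym (lookup∘tabulate vertex i))
        (trans eq (lookup∘tabulate vertex j)))) ,
      (λ i → subst₂ Adj (sym (lookup∘tabulate vertex (inject₁ i)))
        (sym (lookup∘tabulate vertex (suc i))) (step i)) ,
      subst₂ Adj (sym (lookup∘tabulate vertex (fromℕ m))) (sym (lookup∘tabulate vertex zero)) close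
      where open Cycle c

  -- The vertices of a cycle are distinct, so `m < n`, and a search below `n` decides between a
  -- finite girth and infinity.
  girth-≥ : ∀ {g} → (∀ c → g ≤ cycleLength G c) →
    ∃ λ (γ : ℕ ⁺) → IsGirth G γ × [ g ] ≤⁺ γ
  girth-≥ g≤ with least (λ m → anyVec? (suc m) (cycleOn? m)) n
  ... | inj₁ (m , has , minimal) =
    [ suc m ] , ((toCycle has , refl) , λ c → s≤s (minimal _ (fromCycle c))) , [ g≤ (toCycle has) ]
  ... | inj₂ none =
    ⊤⁺ , (λ c → none (Fin.injective⇒≤ (Cycle.distinct c)) (fromCycle c)) , ([ _ ] ≤⊤⁺)

  private
    neighbours : Fin n → List (Fin n)
    neighbours x = filter (adj? x) (allFin n)

    degree : Fin n → ℕ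
    degree x = length (neighbours x)

    isDegree : ∀ x → IsDegree G x (degree x)
    isDegree x = neighbours x , filter⁺ (adj? x) (allFin⁺ n) ,
      (λ y → mk⇔ (proj₂ ∘ ∈-filter⁻ (adj? x) {xs = allFin n})
                 (∈-filter⁺ (adj? x) {xs = allFin n} (∈-allFin y))) ,
      refl

    -- Distinct neighbours occupy distinct positions in the list.
    degree-≥ : ∀ {d x} {h : Fin d → Fin n} → Injective _≡_ _≡_ h →
      (∀ c → Adj x (h c)) → d ≤ degree x
    degree-≥ {x = x} {h} h-inj adj =
      Fin.injective⇒≤ {f = Any.index ∘ member}
        (h-inj ∘ Membership.index-injective (setoid (Fin n)) (member _) (member _))
      where
      member : ∀ c → h c ∈ₗ neighbours x
      member c = ∈-filter⁺ (adj? x) {xs = allFin n} (∈-allFin (h c)) (adj c)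

  minDegree-≥ : ∀ {d} → Fin n →
    (∀ x → Σ (Fin d → Fin n) λ h → Injective _≡_ _≡_ h × (∀ c → Adj x (h c))) →
    ∃ λ δ → IsMinDegree G δ × d ≤ δ
  minDegree-≥ x₀ many = degree x ,
    ((x , isDegree x) ,
     λ y → degree y , isDegree y , All.lookup (f[argmin]≤f[xs] x₀ (allFin n)) (∈-allFin y)) ,
    (let h , h-inj , adj = many x in degree-≥ h-inj adj)
    where
    x : Fin n
    x = argmin degree x₀ (allFin n)

-- Cycles of an incidence graph

Edge : {P Q : Set} → (P → Q → Set) → P ⊎ Q → P ⊎ Q → Set
Edge I (inj₁ p) (inj₂ q) = I p q
Edge I (inj₂ q) (inj₁ p) = I p q
Edge I _        _        = ⊥

module _ {P Q : Set} {I : P → Q → Set} where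

  private
    from-point : ∀ p v → Edge I (inj₁ p) v → ∃ λ q → v ≡ inj₂ q × I p q
    from-point p (inj₂ q) p∈q = q , refl , p∈q

    from-block : ∀ q v → Edge I (inj₂ q) v → ∃ λ p → v ≡ inj₁ p × I p q
    from-block q (inj₁ p) p∈q = p , refl , p∈q

  -- Each block uses up two steps of the sequence, so the walk has half as many blocks as there are
  -- steps; the weaker bound `m ≤ suc n` suffices for the girth.
  sequence⇒walk : ∀ n (w : ℕ → P ⊎ Q) → (∀ i → Edge I (w i) (w (1 + i))) →
    (∀ i → w i ≢ w (2 + i)) → ∀ {p p′} → w 0 ≡ inj₁ p → w (suc n) ≡ inj₁ p′ →
    ∃ λ q → ∃ λ m → w 1 ≡ inj₂ q × m ≤ suc n × Walk I p q p′ m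
  sequence⇒walk n w edge reduced w₀ wₙ
    with q , w₁ , p∈q ← from-point _ (w 1) (subst (λ v → Edge I v (w 1)) w₀ (edge 0))
    with p₁ , w₂ , p₁∈q ← from-block q (w 2) (subst (λ v → Edge I v (w 2)) w₁ (edge 1))
    with n
  ... | 0 with () ← trans (sym w₁) wₙ
  ... | 1 with refl ← trans (sym w₂) wₙ =
    q , 1 , w₁ , s≤s z≤n , single p∈q p₁∈q (λ { refl → reduced 0 (trans w₀ (sym w₂)) })
  ... | suc (suc n′)
    with q₁ , m , w₃ , m≤ , v ← sequence⇒walk n′ (λ i → w (2 + i)) (λ i → edge (2 + i))
           (λ i → reduced (2 + i)) w₂ wₙ =
    q , suc m , w₁ , s≤s (≤-trans m≤ (n≤1+n _)) ,
    cons p∈q p₁∈q (λ { refl → reduced 0 (trans w₀ (sym w₂)) })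
      (λ { refl → reduced 1 (trans w₁ (sym w₃)) }) v

-- Going round a cycle

module _ {m : ℕ} where

  next : Fin (suc m) → Fin (suc m)
  next i with view i
  ... | ‵fromℕ     = zero
  ... | ‵inject₁ j = suc j

  next-cases : ∀ i → (toℕ i ≡ m × next i ≡ zero) ⊎ (toℕ (next i) ≡ suc (toℕ i))
  next-cases i with view i
  ... | ‵fromℕ     = inj₁ (Fin.toℕ-fromℕ m , refl)
  ... | ‵inject₁ j = inj₂ (cong suc (sym (Fin.toℕ-inject₁ j)))

  -- With at least three positions, two steps never return; hence going round a cycle does not
  -- backtrack.
  next²≢ : 2 ≤ m → ∀ i → i ≢ next (next i)
  next²≢ 2≤m i eq with next-cases i | next-cases (next i)
  ... | inj₁ (i≡m , i⁺≡0) | inj₁ (i⁺≡m , _) =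
    <⇒≢ (≤-trans (s≤s z≤n) 2≤m) (trans (sym (cong toℕ i⁺≡0)) i⁺≡m)
  ... | inj₁ (i≡m , i⁺≡0) | inj₂ i⁺⁺ =
    <⇒≢ 2≤m (trans (sym (trans i⁺⁺ (cong (suc ∘ toℕ) i⁺≡0))) (trans (sym (cong toℕ eq)) i≡m))
  ... | inj₂ i⁺ | inj₁ (i⁺≡m , i⁺⁺≡0) =
    <⇒≢ 2≤m (trans (sym (trans i⁺ (cong suc (cong toℕ (trans eq i⁺⁺≡0))))) i⁺≡m)
  ... | inj₂ i⁺ | inj₂ i⁺⁺ =
    <⇒≢ (≤-trans (n<1+n _) (n≤1+n _)) (trans (cong toℕ eq) (trans i⁺⁺ (cong suc i⁺)))

  -- Reduction modulo `suc m`, which unrolls a cycle into the infinite sequence that `sequence⇒walk`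
  -- expects.
  turn : ℕ → Fin (suc m)
  turn zero    = zero
  turn (suc i) = next (turn i)

  toℕ-turn : ∀ {i} → i ≤ m → toℕ (turn i) ≡ i
  toℕ-turn {zero}  _ = refl
  toℕ-turn {suc i} i<m with next-cases (turn i)
  ... | inj₁ (i≡m , _) = contradiction (trans (sym (toℕ-turn (<⇒≤ i<m))) i≡m) (<⇒≢ i<m)
  ... | inj₂ i⁺        = trans i⁺ (cong suc (toℕ-turn (<⇒≤ i<m)))

  turn-period : turn (suc m) ≡ zero
  turn-period with next-cases (turn m)
  ... | inj₁ (_ , eq) = eq
  ... | inj₂ m⁺ = contradiction
    (≤-trans (≤-reflexive (cong suc (sym (trans m⁺ (cong suc (toℕ-turn ≤-refl))))))
      (Fin.toℕ<n (next (turn m))))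
    1+n≰n

cycle-length≥ : ∀ {v e g} {P Q : Set} {I : P → Q → Set} (G : Graph v e)
  (to : Graph.Vertex G → P ⊎ Q) → Injective _≡_ _≡_ to →
  (∀ {x y} → Graph.Adj G x y → Edge I (to x) (to y)) →
  Girth≥ I g → ∀ c → g ≤ cycleLength G c
cycle-length≥ {g = g} {P} {Q} {I} G to to-inj to-edge girth c = by-side (to (vertex zero)) refl
  where
  open Cycle c
  w : ℕ → P ⊎ Q
  w i = to (vertex (turn i))

  next-edge : ∀ i → Edge I (to (vertex i)) (to (vertex (next i)))
  next-edge i with view i
  ... | ‵fromℕ     = to-edge close
  ... | ‵inject₁ j = to-edge (step j)

  edge : ∀ i → Edge I (w i) (w (1 + i))
  edge i = next-edge (turn i)

  reduced : ∀ i → w i ≢ w (2 + i)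
  reduced i = next²≢ 2≤m (turn i) ∘ distinct ∘ to-inj

  closed : ∀ j → w (j + suc m) ≡ w j → ∀ {p} → w j ≡ inj₁ p → g ≤ suc m
  closed j period wⱼ
    with _ , _ , _ , len≤ , v ← sequence⇒walk {I = I} m (λ i → w (i + j)) (λ i → edge (i + j))
           (λ i → reduced (i + j)) wⱼ (trans (cong w (+-comm (suc m) j)) (trans period wⱼ))
    = ≤-trans (girth v) len≤

  by-side : ∀ u → w 0 ≡ u → g ≤ suc m
  by-side (inj₁ p) w₀ = closed 0 (cong (to ∘ vertex) turn-period) w₀
  -- If the cycle starts at a block, the walk starts one step later, at a point.
  by-side (inj₂ q) w₀ with w 1 in w₁ | subst (λ u → Edge I u (w 1)) w₀ (edge 0)
  ... | inj₁ p | _ = closed 1 (cong (to ∘ vertex ∘ next) turn-period) w₁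

-- The point coordinates are shifted by one, so that the half-open rectangle
-- [a , b) becomes the closed one [a + 1 , b].
module Boxes {k g} (𝓐 : Arrangement (suc k) g (suc k)) where
  open Arrangement 𝓐

  V : Set
  V = P ⊎ Q

  level : Q → ℕ
  level q = toℕ (code Q-finite q)

  levels : ℕ
  levels = proj₁ Q-finite

  line : P → NatBox 3
  line p = record
    { lo    = lookup (suc (x p) ∷ suc (y p) ∷ 0 ∷ [])
    ; hi    = lookup (suc (x p) ∷ suc (y p) ∷ levels ∷ [])
    ; lo≤hi = λ { 0F → ≤-refl ; 1F → ≤-refl ; 2F → z≤n }
    }

  slab : Q → NatBox 3
  -- A point in the rectangle shows that the closed bounds are in order.
  slab q with h , _ , h∈q ← points q with (l≤x , x<r) , (b≤y , y<t) ← h∈q zero = record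
    { lo    = lookup (suc (left q) ∷ suc (bottom q) ∷ level q ∷ [])
    ; hi    = lookup (right q ∷ top q ∷ level q ∷ [])
    ; lo≤hi = λ { 0F → ≤-<-trans l≤x x<r ; 1F → ≤-<-trans b≤y y<t ; 2F → ≤-refl }
    }

  boxOf : V → NatBox 3
  boxOf (inj₁ p) = line p
  boxOf (inj₂ q) = slab q

  Edgeᴿ : V → V → Set
  Edgeᴿ = Edge _∈ᴿ_

  edge? : Binary.Decidable Edgeᴿ
  edge? (inj₁ p) (inj₁ _) = no λ ()
  edge? (inj₁ p) (inj₂ q) = ((left q ≤? x p) ×-dec (x p <? right q)) ×-dec
                            ((bottom q ≤? y p) ×-dec (y p <? top q))
  edge? (inj₂ q) (inj₁ p) = edge? (inj₁ p) (inj₂ q)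
  edge? (inj₂ q) (inj₂ _) = no λ ()

  level-injective : ∀ {q q′} → level q ≡ level q′ → q ≡ q′
  level-injective = code-injective Q-finite ∘ Fin.toℕ-injective

  -- Lines are separated by their x-coordinates and slabs by their levels, so only mixed pairs can
  -- meet.
  overlap⇒edge : ∀ u v → u ≢ v → Overlap (boxOf u) (boxOf v) → Edgeᴿ u v
  overlap⇒edge (inj₁ p) (inj₁ p′) u≢v o = u≢v (cong inj₁ (x-injective
    (≤-antisym (s≤s⁻¹ (proj₁ (o 0F))) (s≤s⁻¹ (proj₂ (o 0F))))))
  overlap⇒edge (inj₂ q) (inj₂ q′) u≢v o = u≢v (cong inj₂ (level-injective
    (≤-antisym (proj₁ (o 2F)) (proj₂ (o 2F)))))
  overlap⇒edge (inj₁ p) (inj₂ q) _ o =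
    (s≤s⁻¹ (proj₂ (o 0F)) , proj₁ (o 0F)) , (s≤s⁻¹ (proj₂ (o 1F)) , proj₁ (o 1F))
  overlap⇒edge (inj₂ q) (inj₁ p) _ o =
    (s≤s⁻¹ (proj₁ (o 0F)) , proj₂ (o 0F)) , (s≤s⁻¹ (proj₁ (o 1F)) , proj₂ (o 1F))

  edge⇒overlap : ∀ u v → Edgeᴿ u v → Overlap (boxOf u) (boxOf v)
  edge⇒overlap (inj₁ p) (inj₂ q) ((l≤x , x<r) , (b≤y , y<t)) =
    λ { 0F → x<r , s≤s l≤x ; 1F → y<t , s≤s b≤y ; 2F → z≤n , <⇒≤ (Fin.toℕ<n (code Q-finite q)) }
  edge⇒overlap (inj₂ q) (inj₁ p) p∈q = swap ∘ edge⇒overlap (inj₁ p) (inj₂ q) p∈q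

  edge⇒≢ : ∀ {u v} → Edgeᴿ u v → u ≢ v
  edge⇒≢ {inj₁ _} () refl
  edge⇒≢ {inj₂ _} () refl

  sameSet⇒≡ : ∀ u v → ⟦ natBox (boxOf u) ⟧ ≐ ⟦ natBox (boxOf v) ⟧ → u ≡ v
  sameSet⇒≡ (inj₁ p) (inj₁ p′) (u⊆v , _) = cong inj₁ (x-injective (suc-injective
    (let x′≤x , x≤x′ = ⊆⇒bounds (line p) (line p′) (λ s → u⊆v {s}) 0F in ≤-antisym x≤x′ x′≤x)))
  sameSet⇒≡ (inj₂ q) (inj₂ q′) (u⊆v , _) = cong inj₂ (level-injective
    (let z′≤z , z≤z′ = ⊆⇒bounds (slab q) (slab q′) (λ s → u⊆v {s}) 2F in ≤-antisym z≤z′ z′≤z))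
  -- A line reaches up to `levels`, above every slab.
  sameSet⇒≡ (inj₁ p) (inj₂ q) (u⊆v , _) = contradiction
    (proj₂ (⊆⇒bounds (line p) (slab q) (λ s → u⊆v {s}) 2F)) (<⇒≱ (Fin.toℕ<n (code Q-finite q)))
  sameSet⇒≡ (inj₂ q) (inj₁ p) (_ , v⊆u) = contradiction
    (proj₂ (⊆⇒bounds (line p) (slab q) (λ s → v⊆u {s}) 2F)) (<⇒≱ (Fin.toℕ<n (code Q-finite q)))

  V-finite : Finite V
  V-finite = P-finite ⊎-finite Q-finite

  size : ℕ
  size = proj₁ V-finite

  at : Fin size → V
  at = Inverse.from (proj₂ V-finite)

  at-code : ∀ v → at (code V-finite v) ≡ v
  at-code = Inverse.strictlyInverseʳ (proj₂ V-finite)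

  at-injective : Injective _≡_ _≡_ at
  at-injective {i} {j} eq = trans (sym (Inverse.strictlyInverseˡ (proj₂ V-finite) i))
    (trans (cong (code V-finite) eq) (Inverse.strictlyInverseˡ (proj₂ V-finite) j))

  boxes : BoxCollection 3
  boxes = record
    { size     = size
    ; box      = natBox ∘ boxOf ∘ at
    ; distinct = λ {i} {j} eq → at-injective (sameSet⇒≡ (at i) (at j) eq)
    }

  open Graph (intersectionGraph boxes) using (Adj)

  adj⇒edge : ∀ {i j} → Adj i j → Edgeᴿ (at i) (at j)
  adj⇒edge {i} {j} (i≢j , meet) = overlap⇒edge (at i) (at j) (i≢j ∘ at-injective)
    (meet⇒overlap (boxOf (at i)) (boxOf (at j)) meet)

  edge⇒adj : ∀ {i j} → Edgeᴿ (at i) (at j) → Adj i j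
  edge⇒adj {i} {j} uv = edge⇒≢ uv ∘ cong at ,
    overlap⇒meet (boxOf (at i)) (boxOf (at j)) (edge⇒overlap (at i) (at j) uv)

  -- Intersection of real boxes is decided through comparisons of natural numbers.
  adj? : Binary.Decidable Adj
  adj? i j = map′ edge⇒adj adj⇒edge (edge? (at i) (at j))

  isPoint : V → Bool
  isPoint (inj₁ _) = true
  isPoint (inj₂ _) = false

  bipartite : Bipartite (intersectionGraph boxes)
  bipartite = isPoint ∘ at , λ i j adj → flips (at i) (at j) (adj⇒edge adj)
    where
    flips : ∀ u v → Edgeᴿ u v → isPoint u ≢ isPoint v
    flips (inj₁ _) (inj₂ _) _ ()
    flips (inj₂ _) (inj₁ _) _ ()

  manyEdges : ∀ v → Σ (Fin (suc k) → V) λ h → Injective _≡_ _≡_ h × (∀ c → Edgeᴿ v (h c))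
  manyEdges (inj₁ p) = let h , h-inj , p∈h = rectangles p in inj₂ ∘ h , h-inj ∘ inj₂-injective , p∈h
  manyEdges (inj₂ q) = let h , h-inj , h∈q = points q in inj₁ ∘ h , h-inj ∘ inj₁-injective , h∈q

  manyNeighbours : ∀ i → Σ (Fin (suc k) → Fin size) λ h →
    Injective _≡_ _≡_ h × (∀ c → Adj i (h c))
  manyNeighbours i = let h , h-inj , edges = manyEdges (at i) in
    code V-finite ∘ h , h-inj ∘ code-injective V-finite ,
    λ c → edge⇒adj (subst (Edgeᴿ (at i)) (sym (at-code (h c))) (edges c))

corollary3 : ∀ (g d : ℕ) → 3 ≤ g → 1 ≤ d →
    Σ (BoxCollection 3) λ 𝓑 →
    NonEmpty 𝓑
    × Bipartite (intersectionGraph 𝓑)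
    × (∃ λ (γ : ℕ ⁺) → IsGirth (intersectionGraph 𝓑) γ × [ g ] ≤⁺ γ)
    × (∃ λ (δ : ℕ) → IsMinDegree (intersectionGraph 𝓑) δ × d ≤ δ)
corollary3 g (suc k) _ _ =
  boxes , Fin.nonZeroIndex some , bipartite ,
  girth-≥ (cycle-length≥ (intersectionGraph boxes) at at-injective adj⇒edge girth) ,
  minDegree-≥ some manyNeighbours
  where
  -- Both parameters give `d = suc k`: points per rectangle and rectangles per point.
  𝓐 = arrangement k g (suc k)
  open Arrangement 𝓐 using (girth; point)
  open Boxes 𝓐
  open Graph (intersectionGraph boxes) using (symmetric; loopless)
  open FiniteGraph adj? symmetric loopless
  some : Fin size
  some = code V-finite (inj₁ point)
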